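{- Let $G$ be a connected digraph and let $G[V_1],G[V_2],\ldots,G[V_k]$ be all strongly connected components of $G$. If $G$ has exactly one initial component, then $$\kappa(G)=\kappa\big(\widehat{G[V_1]}\big)\cdot\kappa\big(\widehat{G[V_2]}\big)\cdots\kappa\big(\widehat{G[V_k]}\big).$$
   Context: Digraphs are finite directed graphs without loops; parallel edges are allowed. An arborescence of a digraph $G=(V,E)$ is a subdigraph $A$ spanning all of $V$ with a root vertex from which every vertex is reachable along a unique directed path in $A$ (a rooted directed spanning tree with edges directed away from the root). Arborescences are identified with their edge sets. Let $\mathsf{arb}(G)$ be the set of all arborescences of $G$ (over all roots). Each edge carries a label, which is a polynomial variable; distinct edges of the original digraph $G$ have distinct labels (the edge $e$ itself is used as the variable), and edges of digraphs derived from $G$ keep the label of the edge of $G$ they come from. The Kirchhoff polynomial of a digraph is $\kappa(G)=\sum_{A\in\mathsf{arb}(G)}\prod_{e\in A}e$, where $e$ stands for its label; for a one-vertex digraph $\kappa(G)=1$. $G[V']$ denotes the subdigraph induced by $V'\subseteq V$. A strongly connected component (SCC) of $G$ is an inclusion-maximal strongly connected induced subdigraph; the vertex sets of the SCCs partition $V$. The SCCs are partially ordered by reachability ($G[V_i]\le G[V_j]$ if there is a directed path from $G[V_i]$ to $G[V_j]$); an initial component is a minimal element of this order, i.e. an SCC with no edge entering it from outside. For an SCC $G[V']$ of a digraph $G$ with exactly one initial component, the digraph $\widehat{G[V']}$ is defined as follows. If $G[V']$ is the initial SCC, then $\widehat{G[V']}=G[V']$. Otherwise $\widehat{G[V']}$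 is obtained from $G[V']$ by adding one new vertex $v_{\mathsf{aux}}$ and, for every edge $xy$ of $G$ with $x\notin V'$ and $y\in V'$, adding an edge $v_{\mathsf{aux}}y$ with the same label as $xy$ (different edges $xy$ yield different, possibly parallel, edges). -}

module Defs where

open import Data.Empty using (⊥-elim)
open import Data.Fin.Base using (Fin; zero; suc)
open import Data.Fin.Properties using (_≟_; all?; any?; suc-injective)
open import Data.Fin.Subset
  using (Subset; inside; outside; _∈_; _∉_; _⊆_; _∪_; Nonempty; Empty)
open import Data.Fin.Subset.Properties
  using (_∈?_; _⊆?_; nonempty?; x∈p∪q⁻)
open import Data.Integer.Base using (ℤ; 0ℤ; 1ℤ) renaming (_+_ to _+ℤ_; _*_ to _*ℤ_)
open import Data.List.Base
  using (List; []; _∷_; _++_; _∷ʳ_; foldr; map; filter; allFin; cartesianProductWith)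
open import Data.List.Membership.Propositional using () renaming (_∈_ to _∈ˡ_)
open import Data.List.Membership.Propositional.Properties using (∈-allFin)
open import Data.List.Properties using (∷ʳ-injectiveʳ; ++-conicalʳ)
open import Data.List.Relation.Unary.Any using (here; there)
open import Data.List.Relation.Unary.Unique.Propositional using (Unique)
open import Data.List.Reverse using (Reverse; reverseView; _∶_∶ʳ_) renaming ([] to []ʳ)
open import Data.Nat.Base using (ℕ; zero; suc) renaming (_+_ to _+ℕ_)
open import Data.Nat.Properties using () renaming (_≟_ to _≟ℕ_)
open import Data.Product using (∃; ∃!; ∃-syntax; _×_; _,_; proj₁; proj₂)
open import Data.Sum.Base using (_⊎_; inj₁; inj₂; [_,_]′)
open import Data.Vec.Base as Vec using (Vec; tabulate; replicate; zipWith; _[_]≔_)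
open import Data.Vec.Properties
  using (≡-dec; lookup∘tabulate; lookup⇒[]=; []=⇒lookup)
open import Function.Base using (id; _∘_)
open import Function.Bundles using (_⇔_; mk⇔)
open import Relation.Binary.Construct.Closure.Equivalence using (EqClosure)
open import Relation.Binary.PropositionalEquality
  using (_≡_; _≢_; refl; sym; trans; cong; subst)
open import Relation.Nullary using (Dec; yes; no; does)
open import Relation.Nullary.Decidable as Dec
  using (_×-dec_; _⊎-dec_; _→-dec_; ¬?; dec-true)
open import Relation.Unary using (Decidable)

private
  variable
    m n : ℕ

------------------------------------------------------------------------
-- Polynomials over ℤ in the variables x₀ , … , xₙ₋₁

-- A finite formal sum of terms (coefficient , exponent vector).  The same
-- exponent vector may occur several times, so polynomials are compared by
-- _≈_ and not by _≡_.
Polynomial : ℕ → Set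
Polynomial n = List (ℤ × Vec ℕ n)

coeff : Polynomial n → Vec ℕ n → ℤ
coeff []            α = 0ℤ
coeff ((c , β) ∷ p) α with ≡-dec _≟ℕ_ β α
... | yes _ = c +ℤ coeff p α
... | no  _ = coeff p α

infix 4 _≈_
_≈_ : Polynomial n → Polynomial n → Set
p ≈ q = ∀ α → coeff p α ≡ coeff q α

0ᴾ 1ᴾ : Polynomial n
0ᴾ = []
1ᴾ = (1ℤ , replicate _ 0) ∷ []

var : Fin n → Polynomial n
var i = (1ℤ , replicate _ 0 [ i ]≔ 1) ∷ []

infixl 6 _+ᴾ_
_+ᴾ_ : Polynomial n → Polynomial n → Polynomial n
_+ᴾ_ = _++_

infixl 7 _*ᴾ_
_*ᴾ_ : Polynomial n → Polynomial n → Polynomial n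
_*ᴾ_ = cartesianProductWith λ (c , α) (d , β) → c *ℤ d , zipWith _+ℕ_ α β

∑ ∏ : List (Polynomial n) → Polynomial n
∑ = foldr _+ᴾ_ 0ᴾ
∏ = foldr _*ᴾ_ 1ᴾ

------------------------------------------------------------------------
-- Subsets of Fin n

⟦_⟧ : {P : Fin n → Set} → Decidable P → Subset n
⟦ P? ⟧ = tabulate (λ i → does (P? i))

∈⟦⟧⁻ : {P : Fin n → Set} (P? : Decidable P) {i : Fin n} → i ∈ ⟦ P? ⟧ → P i
∈⟦⟧⁻ P? {i} i∈ with P? i | trans (sym (lookup∘tabulate (does ∘ P?) i)) ([]=⇒lookup i∈)
... | yes p | _ = p

∈⟦⟧⁺ : {P : Fin n → Set} (P? : Decidable P) {i : Fin n} → P i → i ∈ ⟦ P? ⟧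
∈⟦⟧⁺ P? {i} p = lookup⇒[]= i _ (trans (lookup∘tabulate (does ∘ P?) i) (dec-true (P? i) p))

subsets : ∀ n → List (Subset n)
subsets zero    = Vec.[] ∷ []
subsets (suc n) = map (inside Vec.∷_) (subsets n) ++ map (outside Vec.∷_) (subsets n)

------------------------------------------------------------------------
-- Digraphs

-- A finite loopless digraph whose edges are named by their labels: the labels
-- are the polynomial variables Fin m, the edge set is a set of labels, and so
-- distinct edges carry distinct labels while parallel edges are allowed.  Only
-- the values of src and tgt on edges matter.  The vertices form a subset of
-- Fin order, so that subdigraphs need no renumbering.
record Digraph (m : ℕ) : Set where
  field
    order    : ℕ
    vertices : Subset order
    edges    : Subset m
    src tgt  : Fin m → Fin order
    src∈     : ∀ {e} → e ∈ edges → src e ∈ vertices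
    tgt∈     : ∀ {e} → e ∈ edges → tgt e ∈ vertices
    loopless : ∀ {e} → e ∈ edges → src e ≢ tgt e

open Digraph public

-- es is the edge sequence of a directed walk from u to v using only edges in A.
IsWalk : (G : Digraph m) → Subset m → Fin (order G) → Fin (order G) → List (Fin m) → Set
IsWalk G A u v []       = u ≡ v
IsWalk G A u v (e ∷ es) = e ∈ A × src G e ≡ u × IsWalk G A (tgt G e) v es

Adjacent : (G : Digraph m) → Fin (order G) → Fin (order G) → Set
Adjacent G u v = ∃[ e ] (e ∈ edges G × src G e ≡ u × tgt G e ≡ v)

-- Connectedness of the underlying undirected graph.
Connected : Digraph m → Set
Connected G = ∀ {u v} → u ∈ vertices G → v ∈ vertices G → EqClosure (Adjacent G) u v

------------------------------------------------------------------------
-- Arborescences and the Kirchhoff polynomial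

-- Uniqueness is among all directed walks.  If only walks without repeated
-- vertices were considered, A could also contain edges into the root, and would
-- not be a tree.
IsRootedAt : (G : Digraph m) → Subset m → Fin (order G) → Set
IsRootedAt G A r = ∀ v → v ∈ vertices G → ∃! _≡_ (IsWalk G A r v)

IsArborescence : Digraph m → Subset m → Set
IsArborescence G A = A ⊆ edges G × ∃[ r ] (r ∈ vertices G × IsRootedAt G A r)

-- Deciding whether A is an arborescence, needed to enumerate them.
module _ (G : Digraph m) (A : Subset m) where

  private
    V : Set
    V = Fin (order G)

  walk-++ : ∀ {u v w} es {fs} →
            IsWalk G A u v es → IsWalk G A v w fs → IsWalk G A u w (es ++ fs)
  walk-++ []       refl          q = q
  walk-++ (e ∷ es) (e∈ , s , p)  q = e∈ , s , walk-++ es p q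

  walk-∷ʳ⁻ : ∀ {u v} es {e} → IsWalk G A u v (es ∷ʳ e) →
             IsWalk G A u (src G e) es × e ∈ A × tgt G e ≡ v
  walk-∷ʳ⁻ []       (e∈ , s , t) = sym s , e∈ , t
  walk-∷ʳ⁻ (f ∷ es) (f∈ , s , p) with walk-∷ʳ⁻ es p
  ... | q , e∈ , t = (f∈ , s , q) , e∈ , t

  walk-∷ʳ⁺ : ∀ {u} es {e} → IsWalk G A u (src G e) es → e ∈ A →
             IsWalk G A u (tgt G e) (es ∷ʳ e)
  walk-∷ʳ⁺ es p e∈ = walk-++ es p (e∈ , refl , refl)

  -- Walks from u to v whose interior vertices lie in xs.
  Via : List V → V → V → Set
  Via []       u v = u ≡ v ⊎ ∃[ e ] (e ∈ A × src G e ≡ u × tgt G e ≡ v)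
  Via (x ∷ xs) u v = Via xs u v ⊎ (Via xs u x × Via xs x v)

  via? : ∀ xs u v → Dec (Via xs u v)
  via? []       u v =
    u ≟ v ⊎-dec any? (λ e → (e ∈? A) ×-dec (src G e ≟ u) ×-dec (tgt G e ≟ v))
  via? (x ∷ xs) u v = via? xs u v ⊎-dec (via? xs u x ×-dec via? xs x v)

  via⇒walk : ∀ xs {u v} → Via xs u v → ∃ (IsWalk G A u v)
  via⇒walk []       (inj₁ u≡v)              = [] , u≡v
  via⇒walk []       (inj₂ (e , e∈ , s , t)) = e ∷ [] , e∈ , s , t
  via⇒walk (x ∷ xs) (inj₁ p)                = via⇒walk xs p
  via⇒walk (x ∷ xs) (inj₂ (p , q)) with via⇒walk xs p | via⇒walk xs q
  ... | es , p′ | fs , q′ = es ++ fs , walk-++ es p′ q′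

  via-[] : ∀ xs {u v} → Via [] u v → Via xs u v
  via-[] []       p = p
  via-[] (x ∷ xs) p = inj₁ (via-[] xs p)

  via-trans : ∀ {xs x u v} → x ∈ˡ xs → Via xs u x → Via xs x v → Via xs u v
  via-trans (here refl) p q = inj₂ ([ id , proj₁ ]′ p , [ id , proj₂ ]′ q)
  via-trans (there x∈) (inj₁ p)       (inj₁ q)       = inj₁ (via-trans x∈ p q)
  via-trans (there x∈) (inj₁ p)       (inj₂ (q , r)) = inj₂ (via-trans x∈ p q , r)
  via-trans (there x∈) (inj₂ (p , q)) (inj₁ r)       = inj₂ (p , via-trans x∈ q r)
  via-trans (there x∈) (inj₂ (p , _)) (inj₂ (_ , s)) = inj₂ (p , s)

  walk⇒via : ∀ {u v} es → IsWalk G A u v es → Via (allFin (order G)) u v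
  walk⇒via []       u≡v          = via-[] (allFin _) (inj₁ u≡v)
  walk⇒via (e ∷ es) (e∈ , s , p) =
    via-trans (∈-allFin (tgt G e))
              (via-[] (allFin _) (inj₂ (e , e∈ , s , refl)))
              (walk⇒via es p)

  walk? : ∀ u v → Dec (∃ (IsWalk G A u v))
  walk? u v = Dec.map (mk⇔ (via⇒walk (allFin _)) (λ (es , p) → walk⇒via es p))
                      (via? (allFin _) u v)

  NoEdgeInto : V → Set
  NoEdgeInto r = ∀ e → e ∈ A → tgt G e ≢ r

  InDegree≤1 : Set
  InDegree≤1 = ∀ e → e ∈ A → ∀ f → f ∈ A → tgt G e ≡ tgt G f → e ≡ f

  Reaches : V → Set
  Reaches r = ∀ v → v ∈ vertices G → ∃ (IsWalk G A r v)

  walk-unique : ∀ {r} → NoEdgeInto r → InDegree≤1 →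
                ∀ {v es fs} → Reverse es → Reverse fs →
                IsWalk G A r v es → IsWalk G A r v fs → es ≡ fs
  walk-unique nr d []ʳ             []ʳ             p    q = refl
  walk-unique nr d []ʳ             (fs ∶ _ ∶ʳ f)   refl q with walk-∷ʳ⁻ fs q
  ... | _ , f∈ , t = ⊥-elim (nr f f∈ t)
  walk-unique nr d (es ∶ _ ∶ʳ e)   []ʳ             p refl with walk-∷ʳ⁻ es p
  ... | _ , e∈ , t = ⊥-elim (nr e e∈ t)
  walk-unique nr d (es ∶ res ∶ʳ e) (fs ∶ rfs ∶ʳ f) p q
    with walk-∷ʳ⁻ es p | walk-∷ʳ⁻ fs q
  ... | p′ , e∈ , t | q′ , f∈ , t′ with d e e∈ f f∈ (trans t (sym t′))
  ... | refl = cong (_∷ʳ e) (walk-unique nr d res rfs p′ q′)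

  rooted⇔ : A ⊆ edges G → ∀ {r} → r ∈ vertices G →
            (NoEdgeInto r × InDegree≤1 × Reaches r) ⇔ IsRootedAt G A r
  rooted⇔ A⊆ {r} r∈ = mk⇔ to from
    where
    to : NoEdgeInto r × InDegree≤1 × Reaches r → IsRootedAt G A r
    to (nr , d , reach) v v∈ with reach v v∈
    ... | es , p = es , p , λ {fs} q → walk-unique nr d (reverseView es) (reverseView fs) p q

    from : IsRootedAt G A r → NoEdgeInto r × InDegree≤1 × Reaches r
    from R = nr , d , λ v v∈ → proj₁ (R v v∈) , proj₁ (proj₂ (R v v∈))
      where
      same : ∀ {v es fs} → v ∈ vertices G → IsWalk G A r v es → IsWalk G A r v fs → es ≡ fs
      same v∈ p q = let _ , _ , u = R _ v∈ in trans (sym (u p)) (u q)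

      walkTo : ∀ {e} → e ∈ A → ∃[ es ] IsWalk G A r (tgt G e) (es ∷ʳ e)
      walkTo e∈ = let es , p , _ = R _ (src∈ G (A⊆ e∈)) in es , walk-∷ʳ⁺ es p e∈

      nr : NoEdgeInto r
      nr e e∈ refl with walkTo e∈
      ... | es , p with ++-conicalʳ es _ (same r∈ p refl)
      ... | ()

      d : InDegree≤1
      d e e∈ f f∈ t with walkTo e∈ | walkTo f∈
      ... | es , p | fs , q =
        ∷ʳ-injectiveʳ es fs
          (same (tgt∈ G (A⊆ f∈)) (subst (λ v → IsWalk G A r v (es ∷ʳ e)) t p) q)

  rooted? : A ⊆ edges G → ∀ {r} → r ∈ vertices G → Dec (IsRootedAt G A r)
  rooted? A⊆ {r} r∈ = Dec.map (rooted⇔ (λ {e} → A⊆ {e}) r∈)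
    ( all? (λ e → (e ∈? A) →-dec ¬? (tgt G e ≟ r))
    ×-dec all? (λ e → (e ∈? A) →-dec
            all? (λ f → (f ∈? A) →-dec ((tgt G e ≟ tgt G f) →-dec (e ≟ f))))
    ×-dec all? (λ v → (v ∈? vertices G) →-dec walk? r v) )

  arborescence? : Dec (IsArborescence G A)
  arborescence? with A ⊆? edges G
  ... | no  A⊈ = no (A⊈ ∘ proj₁)
  ... | yes A⊆ = Dec.map (mk⇔ (λ root → (λ {e} → A⊆ {e}) , root) proj₂) (any? root?)
    where
    root? : ∀ r → Dec (r ∈ vertices G × IsRootedAt G A r)
    root? r with r ∈? vertices G
    ... | no  r∉ = no (r∉ ∘ proj₁)
    ... | yes r∈ = Dec.map (mk⇔ (r∈ ,_) proj₂) (rooted? (λ {e} → A⊆ {e}) r∈)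

arb : Digraph m → List (Subset m)
arb G = filter (arborescence? G) (subsets _)

κ : Digraph m → Polynomial m
κ G = ∑ (map (λ A → ∏ (map var (filter (_∈? A) (allFin _)))) (arb G))

------------------------------------------------------------------------
-- Strongly connected components

module _ (G : Digraph m) (W : Subset (order G)) where

  inducedEdge? : ∀ e → Dec (e ∈ edges G × src G e ∈ W × tgt G e ∈ W)
  inducedEdge? e = (e ∈? edges G) ×-dec (src G e ∈? W) ×-dec (tgt G e ∈? W)

  -- G[W], for W ⊆ vertices G.
  induced : Digraph m
  induced = record
    { order    = order G
    ; vertices = W
    ; edges    = ⟦ inducedEdge? ⟧
    ; src      = src G
    ; tgt      = tgt G
    ; src∈     = λ e∈ → proj₁ (proj₂ (∈⟦⟧⁻ inducedEdge? e∈))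
    ; tgt∈     = λ e∈ → proj₂ (proj₂ (∈⟦⟧⁻ inducedEdge? e∈))
    ; loopless = λ e∈ → loopless G (proj₁ (∈⟦⟧⁻ inducedEdge? e∈))
    }

  enteringEdge? : ∀ e → Dec (e ∈ edges G × src G e ∉ W × tgt G e ∈ W)
  enteringEdge? e = (e ∈? edges G) ×-dec ¬? (src G e ∈? W) ×-dec (tgt G e ∈? W)

  entering : Subset m
  entering = ⟦ enteringEdge? ⟧

StronglyConnected : Digraph m → Set
StronglyConnected G =
  Nonempty (vertices G) ×
  (∀ u v → u ∈ vertices G → v ∈ vertices G → ∃ (IsWalk G (edges G) u v))

IsSCC : (G : Digraph m) → Subset (order G) → Set
IsSCC G W =
  W ⊆ vertices G × StronglyConnected (induced G W) ×
  (∀ W′ → W′ ⊆ vertices G → StronglyConnected (induced G W′) → W ⊆ W′ → W′ ≡ W)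

IsInitialComponent : (G : Digraph m) → Subset (order G) → Set
IsInitialComponent G W = IsSCC G W × Empty (entering G W)

-- Ws lists the vertex sets of all strongly connected components, each once.
AreAllSCCs : (G : Digraph m) → List (Subset (order G)) → Set
AreAllSCCs G Ws = Unique Ws × (∀ W → W ∈ˡ Ws ⇔ IsSCC G W)

------------------------------------------------------------------------
-- The digraph obtained from G[W] by adding the auxiliary vertex

module _ (G : Digraph m) (W : Subset (order G)) where

  private
    E : Subset m
    E = edges (induced G W) ∪ entering G W

    target : ∀ {e} → e ∈ E → tgt G e ∈ W
    target e∈ = [ tgt∈ (induced G W)
                , (λ e∈′ → proj₂ (proj₂ (∈⟦⟧⁻ (enteringEdge? G W) e∈′))) ]′ (x∈p∪q⁻ _ _ e∈)

    edge : ∀ {e} → e ∈ E → e ∈ edges G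
    edge e∈ = [ (λ e∈′ → proj₁ (∈⟦⟧⁻ (inducedEdge? G W) e∈′))
              , (λ e∈′ → proj₁ (∈⟦⟧⁻ (enteringEdge? G W) e∈′)) ]′ (x∈p∪q⁻ _ _ e∈)

  -- The new vertex is zero, and a vertex v of G becomes suc v.
  auxSrc : Fin m → Fin (suc (order G))
  auxSrc e with src G e ∈? W
  ... | yes _ = suc (src G e)
  ... | no  _ = zero

  withAux : Digraph m
  withAux = record
    { order    = suc (order G)
    ; vertices = inside Vec.∷ W
    ; edges    = E
    ; src      = auxSrc
    ; tgt      = suc ∘ tgt G
    ; src∈     = λ {e} _ → auxSrc∈ e
    ; tgt∈     = Vec.there ∘ target
    ; loopless = λ {e} e∈ → auxLoopless e (edge e∈)
    }
    where
    auxSrc∈ : ∀ e → auxSrc e ∈ inside Vec.∷ W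
    auxSrc∈ e with src G e ∈? W
    ... | yes s∈ = Vec.there s∈
    ... | no  _  = Vec.here

    auxLoopless : ∀ e → e ∈ edges G → auxSrc e ≢ suc (tgt G e)
    auxLoopless e e∈ with src G e ∈? W
    ... | yes _ = loopless G e∈ ∘ suc-injective
    ... | no  _ = λ ()

  -- An SCC is initial exactly when no edge enters it.
  hat : Digraph m
  hat with nonempty? (entering G W)
  ... | yes _ = withAux
  ... | no  _ = induced G W

{-# OPTIONS --safe #-}

-- Every edge of G enters exactly one strongly connected component, so the edge
-- sets of the digraphs hat G W partition the edges of G.  A set A of edges is an
-- arborescence of G exactly when each part A ∩ incoming W is an arborescence of
-- hat G W.  Restricting works because a walk of A ending in W, cut at its last
-- entrance into W, becomes a walk from the auxiliary vertex.  For the converse,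
-- the root of the initial component reaches every v by induction on the set of
-- ancestors of v in G, which shrinks strictly on passing from a vertex of W to
-- the source of an edge entering W.  All monomials have coefficient 1, so this
-- bijection makes the two polynomials equal as lists of terms up to permutation.

module Submission where

open import Defs
open import Data.Empty using (⊥-elim)
open import Data.Fin.Base using (Fin; zero; suc)
open import Data.Fin.Properties using (suc-injective)
open import Data.Fin.Subset
  using (Subset; inside; outside; _∈_; _∉_; _⊆_; _⊂_; _∩_; ⋃; Nonempty; Empty)
open import Data.Fin.Subset.Induction using (⊂-wellFounded; Acc; acc)
open import Data.Fin.Subset.Properties
  using (_∈?_; nonempty?; x∈p∪q⁻; x∈p∪q⁺; x∈p∩q⁻; x∈p∩q⁺; ⊆-antisym; ∉⊥)
open import Data.Integer.Base using (ℤ; 1ℤ) renaming (_+_ to _+ℤ_)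
import Data.Integer.Properties as ℤ
open import Data.List.Base
  using (List; []; _∷_; _++_; map; filter; foldr; concat; allFin; cartesianProductWith)
open import Data.List.Membership.Propositional using (find; lose) renaming (_∈_ to _∈ˡ_)
open import Data.List.Membership.Propositional.Properties
  using ( ∈-allFin; ∈-map⁺; ∈-map⁻; ∈-++⁺ˡ; ∈-++⁺ʳ; ∈-filter⁺; ∈-filter⁻; ∈-concat⁺; ∈-concat⁻
        ; ∈-cartesianProductWith⁺; ∈-cartesianProductWith⁻ )
open import Data.List.Membership.Propositional.Properties.WithK using (unique∧set⇒bag)
open import Data.List.Properties using (map-++; map-∘; map-cong; map-cong-local; ∷-injective)
open import Data.List.Relation.Binary.BagAndSetEquality using (∼bag⇒↭)
open import Data.List.Relation.Binary.Permutation.Propositional as ↭ using (_↭_)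
import Data.List.Relation.Binary.Permutation.Propositional.Properties as ↭
open import Data.List.Relation.Binary.Pointwise using (Pointwise; []; _∷_)
open import Data.List.Relation.Unary.All as All using (All; []; _∷_)
import Data.List.Relation.Unary.All.Properties as All
open import Data.List.Relation.Unary.AllPairs as AllPairs using (AllPairs; []; _∷_)
import Data.List.Relation.Unary.AllPairs.Properties as AllPairs
open import Data.List.Relation.Unary.Any as Any using (Any; here; there)
import Data.List.Relation.Unary.Any.Properties as Any
open import Data.List.Relation.Unary.Unique.Propositional using (Unique)
import Data.List.Relation.Unary.Unique.Propositional.Properties as Unique
open import Data.Nat.Base using (ℕ; zero; suc) renaming (_+_ to _+ℕ_)
import Data.Nat.Properties as ℕ
open import Data.Product using (∃; ∃!; ∃-syntax; _×_; _,_; proj₁; proj₂)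
open import Data.Sum.Base using (_⊎_; inj₁; inj₂)
open import Data.Vec.Base as Vec using (Vec; replicate; zipWith; _[_]≔_)
import Data.Vec.Properties as Vec
open import Function.Base using (_∘_)
open import Function.Bundles using (_⇔_; mk⇔; Equivalence)
open import Relation.Binary.PropositionalEquality
  using (_≡_; _≢_; refl; sym; trans; cong; cong₂; subst; module ≡-Reasoning)
open import Relation.Nullary using (Dec; yes; no; ¬_)
open import Relation.Nullary.Decidable using (_×-dec_)

private
  variable
    A B C D : Set
    m n : ℕ

-- Lists without repetition

-- Injectivity is asked only on members of `xs`: `split` loses labels outside `edges G`, so it is
-- known to be injective on arborescences but not on arbitrary sets of labels.
unique-map⁺ : ∀ {f : A → B} {xs} →
              (∀ {x y} → x ∈ˡ xs → y ∈ˡ xs → f x ≡ f y → x ≡ y) →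
              Unique xs → Unique (map f xs)
unique-map⁺ inj []         = []
unique-map⁺ inj (x∉ ∷ xs!) =
  All.map⁺ (All.tabulate (λ y∈ fx≡fy → All.lookup x∉ y∈ (inj (here refl) (there y∈) fx≡fy)))
  ∷ unique-map⁺ (λ x∈ y∈ → inj (there x∈) (there y∈)) xs!

unique-set⇒↭ : ∀ {xs ys : List A} → Unique xs → Unique ys →
               (∀ {x} → x ∈ˡ xs ⇔ x ∈ˡ ys) → xs ↭ ys
unique-set⇒↭ xs! ys! same = ∼bag⇒↭ (unique∧set⇒bag xs! ys! same)

bijection⇒↭ : ∀ (f : A → B) (g : B → A) {xs ys} → Unique xs → Unique ys →
              (∀ {x} → x ∈ˡ xs → f x ∈ˡ ys × g (f x) ≡ x) →
              (∀ {y} → y ∈ˡ ys → g y ∈ˡ xs × f (g y) ≡ y) →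
              map f xs ↭ ys
bijection⇒↭ f g {xs} {ys} xs! ys! to from = unique-set⇒↭
  (unique-map⁺ (λ x∈ y∈ eq → trans (sym (proj₂ (to x∈))) (trans (cong g eq) (proj₂ (to y∈)))) xs!)
  ys!
  (mk⇔ image preimage)
  where
  image : ∀ {y} → y ∈ˡ map f xs → y ∈ˡ ys
  image y∈ with ∈-map⁻ f y∈
  ... | x , x∈ , refl = proj₁ (to x∈)

  preimage : ∀ {y} → y ∈ˡ ys → y ∈ˡ map f xs
  preimage y∈ = subst (_∈ˡ map f xs) (proj₂ (from y∈)) (∈-map⁺ f (proj₁ (from y∈)))

allPairs-zipWith : ∀ {P : A → Set} {R S : A → A → Set} →
                   (∀ {x y} → P x → P y → R x y → S x y) →
                   ∀ {xs} → All P xs → AllPairs R xs → AllPairs S xs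
allPairs-zipWith f []         []         = []
allPairs-zipWith f (px ∷ pxs) (rx ∷ rxs) =
  All.zipWith (λ (py , r) → f px py r) (pxs , rx) ∷ allPairs-zipWith f pxs rxs

-- The Cartesian product of a list of lists, built with the same fold as `∏` so that its order is
-- the order in which a product of sums expands.
choices : List (List A) → List (List A)
choices = foldr (cartesianProductWith _∷_) ([] ∷ [])

choices-unique : ∀ {xss : List (List A)} → All Unique xss → Unique (choices xss)
choices-unique []           = [] ∷ []
choices-unique (xs! ∷ xss!) =
  Unique.cartesianProductWith⁺ _∷_ ∷-injective xs! (choices-unique xss!)

∈-choices⁺ : ∀ {xs} {xss : List (List A)} → Pointwise _∈ˡ_ xs xss → xs ∈ˡ choices xss
∈-choices⁺ []         = here refl
∈-choices⁺ (x∈ ∷ xs∈) = ∈-cartesianProductWith⁺ _∷_ x∈ (∈-choices⁺ xs∈)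

∈-choices⁻ : ∀ {xs} (xss : List (List A)) → xs ∈ˡ choices xss → Pointwise _∈ˡ_ xs xss
∈-choices⁻ []         (here refl) = []
∈-choices⁻ (ys ∷ yss) xs∈ with ∈-cartesianProductWith⁻ _∷_ ys (choices yss) xs∈
... | _ , _ , x∈ , xs∈′ , refl = x∈ ∷ ∈-choices⁻ yss xs∈′

map-cartesianProductWith :
  ∀ {A′ B′ : Set} {f : A → B → C} {g : A′ → B′ → D} {h : C → D} {k : A → A′} {l : B → B′} →
  (∀ x y → h (f x y) ≡ g (k x) (l y)) → ∀ xs ys →
  map h (cartesianProductWith f xs ys) ≡ cartesianProductWith g (map k xs) (map l ys)
map-cartesianProductWith eq []       ys = refl
map-cartesianProductWith {f = f} {g} {h} {k} {l} eq (x ∷ xs) ys = begin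
  map h (map (f x) ys ++ cartesianProductWith f xs ys)
    ≡⟨ map-++ h (map (f x) ys) _ ⟩
  map h (map (f x) ys) ++ map h (cartesianProductWith f xs ys)
    ≡⟨ cong₂ _++_ (trans (sym (map-∘ ys)) (trans (map-cong (eq x) ys) (map-∘ ys)))
                  (map-cartesianProductWith eq xs ys) ⟩
  map (g (k x)) (map l ys) ++ cartesianProductWith g (map k xs) (map l ys) ∎
  where open ≡-Reasoning

pointwise-map⁺ : ∀ {R : B → C → Set} {f : A → B} {g : A → C} {xs} →
                 All (λ x → R (f x) (g x)) xs → Pointwise R (map f xs) (map g xs)
pointwise-map⁺ []       = []
pointwise-map⁺ (r ∷ rs) = r ∷ pointwise-map⁺ rs

pointwise-map⁻ : ∀ {R : B → C → Set} {f : A → B} {g : A → C} xs →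
                 Pointwise R (map f xs) (map g xs) → All (λ x → R (f x) (g x)) xs
pointwise-map⁻ []       []       = []
pointwise-map⁻ (x ∷ xs) (r ∷ rs) = r ∷ pointwise-map⁻ xs rs

pointwise-mapʳ : ∀ {R : A → C → Set} {S : A → D → Set} {g : B → C} {h : B → D} →
                 (∀ {x y} → R x (g y) → S x (h y)) →
                 ∀ {xs} ys → Pointwise R xs (map g ys) → Pointwise S xs (map h ys)
pointwise-mapʳ f []       []       = []
pointwise-mapʳ f (y ∷ ys) (r ∷ rs) = f r ∷ pointwise-mapʳ f ys rs

-- Subsets

subsets-complete : ∀ (S : Subset n) → S ∈ˡ subsets n
subsets-complete Vec.[]              = here refl
subsets-complete (inside  Vec.∷ S) = ∈-++⁺ˡ (∈-map⁺ _ (subsets-complete S))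
subsets-complete (outside Vec.∷ S) = ∈-++⁺ʳ _ (∈-map⁺ _ (subsets-complete S))

subsets-unique : ∀ n → Unique (subsets n)
subsets-unique zero    = [] ∷ []
subsets-unique (suc n) = Unique.++⁺
  (Unique.map⁺ Vec.∷-injectiveʳ (subsets-unique n))
  (Unique.map⁺ Vec.∷-injectiveʳ (subsets-unique n))
  disjoint
  where
  disjoint : ∀ {S} → ¬ (S ∈ˡ map (inside Vec.∷_) (subsets n) ×
                        S ∈ˡ map (outside Vec.∷_) (subsets n))
  disjoint (S∈ , S∈′) with ∈-map⁻ _ S∈ | ∈-map⁻ _ S∈′
  ... | _ , _ , refl | _ , _ , ()

∈-⋃⁺ : ∀ {x : Fin n} {Ss} → Any (x ∈_) Ss → x ∈ ⋃ Ss
∈-⋃⁺ (here x∈)  = x∈p∪q⁺ (inj₁ x∈)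
∈-⋃⁺ (there x∈) = x∈p∪q⁺ (inj₂ (∈-⋃⁺ x∈))

∈-⋃⁻ : ∀ {x : Fin n} Ss → x ∈ ⋃ Ss → Any (x ∈_) Ss
∈-⋃⁻ []       x∈ = ⊥-elim (∉⊥ x∈)
∈-⋃⁻ (S ∷ Ss) x∈ with x∈p∪q⁻ S (⋃ Ss) x∈
... | inj₁ x∈S  = here x∈S
... | inj₂ x∈Ss = there (∈-⋃⁻ Ss x∈Ss)

DisjointSubsets : Subset n → Subset n → Set
DisjointSubsets S T = ∀ {x} → x ∈ S → x ∉ T

any-Pointwise : ∀ {R : A → B → Set} {P : A → Set} {Q : B → Set} →
                (∀ {x y} → R x y → P x → Q y) →
                ∀ {xs ys} → Pointwise R xs ys → Any P xs → Any Q ys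
any-Pointwise f (r ∷ _)  (here px)   = here (f r px)
any-Pointwise f (_ ∷ rs) (there pxs) = there (any-Pointwise f rs pxs)

-- An element of the union that lies in a part `E` comes from some member of `Bs` with its own part,
-- and disjointness forces that part to be `E`. Together with `⋃-parts` this makes splitting and
-- union mutually inverse.
⋃-∩-parts : ∀ {Es Bs : List (Subset n)} → AllPairs DisjointSubsets Es →
            Pointwise _⊆_ Bs Es → map (⋃ Bs ∩_) Es ≡ Bs
⋃-∩-parts []           []               = refl
⋃-∩-parts {Es = E ∷ Es} {B ∷ Bs} (E# ∷ Es#) (B⊆ ∷ Bs⊆) = cong₂ _∷_
  (⊆-antisym B∪-∩E⊆B (λ x∈ → x∈p∩q⁺ (x∈p∪q⁺ (inj₁ x∈) , B⊆ x∈)))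
  (trans (map-cong-local (All.map drop-B E#)) (⋃-∩-parts Es# Bs⊆))
  where
  B∪-∩E⊆B : (⋃ (B ∷ Bs) ∩ E) ⊆ B
  B∪-∩E⊆B x∈ with x∈p∩q⁻ _ E x∈
  ... | x∈⋃ , x∈E with x∈p∪q⁻ B (⋃ Bs) x∈⋃
  ... | inj₁ x∈B  = x∈B
  ... | inj₂ x∈Bs with find (any-Pointwise (λ B⊆E x∈B → B⊆E x∈B) Bs⊆ (∈-⋃⁻ Bs x∈Bs))
  ... | F , F∈ , x∈F = ⊥-elim (All.lookup E# F∈ x∈E x∈F)

  drop-B : ∀ {F} → DisjointSubsets E F → ⋃ (B ∷ Bs) ∩ F ≡ ⋃ Bs ∩ F
  drop-B {F} E#F = ⊆-antisym
    (λ x∈ → let x∈⋃ , x∈F = x∈p∩q⁻ _ F x∈ in x∈p∩q⁺ (rest x∈F (x∈p∪q⁻ B _ x∈⋃) , x∈F))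
    (λ x∈ → let x∈⋃ , x∈F = x∈p∩q⁻ _ F x∈ in x∈p∩q⁺ (x∈p∪q⁺ (inj₂ x∈⋃) , x∈F))
    where
    rest : ∀ {x} → x ∈ F → x ∈ B ⊎ x ∈ ⋃ Bs → x ∈ ⋃ Bs
    rest x∈F (inj₁ x∈B)  = ⊥-elim (E#F (B⊆ x∈B) x∈F)
    rest x∈F (inj₂ x∈Bs) = x∈Bs

⋃-parts : ∀ {S : Subset n} {Es} → (∀ {x} → x ∈ S → Any (x ∈_) Es) → ⋃ (map (S ∩_) Es) ≡ S
⋃-parts {S = S} {Es} cover = ⊆-antisym
  (λ x∈ → let _ , _ , x∈∩ = find (Any.map⁻ (∈-⋃⁻ (map (S ∩_) Es) x∈)) in proj₁ (x∈p∩q⁻ S _ x∈∩))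
  (λ x∈ → ∈-⋃⁺ (Any.map⁺ (Any.map (λ x∈E → x∈p∩q⁺ (x∈ , x∈E)) (cover x∈))))

-- The same enumeration as in `κ`, so results about it apply to `κ` by definitional equality.
elements : Subset n → List (Fin n)
elements S = filter (_∈? S) (allFin _)

∈-elements⁺ : ∀ {S : Subset n} {x} → x ∈ S → x ∈ˡ elements S
∈-elements⁺ {S = S} x∈ = ∈-filter⁺ (_∈? S) (∈-allFin _) x∈

∈-elements⁻ : ∀ (S : Subset n) {x} → x ∈ˡ elements S → x ∈ S
∈-elements⁻ S x∈ = proj₂ (∈-filter⁻ (_∈? S) {xs = allFin _} x∈)

elements-unique : ∀ (S : Subset n) → Unique (elements S)
elements-unique S = Unique.filter⁺ (_∈? S) (Unique.allFin⁺ _)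

-- Both lists are free of repetition and have the same members. Regrouping by parts changes the
-- order, so equality of lists cannot be expected.
elements-↭ : ∀ {S : Subset n} {Es} → AllPairs DisjointSubsets Es →
             (∀ {x} → x ∈ S → Any (x ∈_) Es) →
             elements S ↭ concat (map elements (map (S ∩_) Es))
elements-↭ {S = S} {Es} Es# cover = unique-set⇒↭ (elements-unique S)
  (Unique.concat⁺ (All.map⁺ (All.tabulate (λ {T} _ → elements-unique T)))
                  (AllPairs.map⁺ (AllPairs.map⁺ (AllPairs.map disjoint Es#))))
  (mk⇔ (λ x∈ → ∈-concat⁺ (Any.map⁺ (Any.map⁺
           (Any.map (λ x∈E → ∈-elements⁺ (x∈p∩q⁺ (∈-elements⁻ S x∈ , x∈E))) (cover (∈-elements⁻ S x∈))))))
       (λ x∈ → let _ , _ , x∈∩ = find (Any.map⁻ (Any.map⁻ (∈-concat⁻ (map elements (map (S ∩_) Es)) x∈)))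
               in ∈-elements⁺ (proj₁ (x∈p∩q⁻ S _ (∈-elements⁻ _ x∈∩)))))
  where
  disjoint : ∀ {E F} → DisjointSubsets E F →
             ∀ {x} → ¬ (x ∈ˡ elements (S ∩ E) × x ∈ˡ elements (S ∩ F))
  disjoint E#F (x∈E , x∈F) = E#F (proj₂ (x∈p∩q⁻ S _ (∈-elements⁻ _ x∈E)))
                                 (proj₂ (x∈p∩q⁻ S _ (∈-elements⁻ _ x∈F)))

-- Polynomials as lists of monomials

-- Writing the head term as a one-term polynomial confines the comparison of exponent vectors to
-- this place; afterwards only the laws of addition are needed.
coeff-∷ : ∀ (t : ℤ × Vec ℕ n) p α → coeff (t ∷ p) α ≡ coeff (t ∷ []) α +ℤ coeff p α
coeff-∷ (c , β) p α with Vec.≡-dec ℕ._≟_ β α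
... | yes _ = cong (_+ℤ coeff p α) (sym (ℤ.+-identityʳ c))
... | no  _ = sym (ℤ.+-identityˡ (coeff p α))

↭⇒≈ : ∀ {p q : Polynomial n} → p ↭ q → p ≈ q
↭⇒≈ ↭.refl              α = refl
↭⇒≈ (↭.prep {xs = p} {q} t p↭q) α = begin
  coeff (t ∷ p) α                  ≡⟨ coeff-∷ t p α ⟩
  coeff (t ∷ []) α +ℤ coeff p α    ≡⟨ cong (coeff (t ∷ []) α +ℤ_) (↭⇒≈ p↭q α) ⟩
  coeff (t ∷ []) α +ℤ coeff q α    ≡⟨ coeff-∷ t q α ⟨
  coeff (t ∷ q) α                  ∎
  where open ≡-Reasoning
↭⇒≈ (↭.swap {xs = p} {q} s t p↭q) α = begin
  coeff (s ∷ t ∷ p) α              ≡⟨ coeff-∷ s (t ∷ p) α ⟩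
  a +ℤ coeff (t ∷ p) α             ≡⟨ cong (a +ℤ_) (coeff-∷ t p α) ⟩
  a +ℤ (b +ℤ coeff p α)            ≡⟨ ℤ.+-assoc a b _ ⟨
  (a +ℤ b) +ℤ coeff p α            ≡⟨ cong₂ _+ℤ_ (ℤ.+-comm a b) (↭⇒≈ p↭q α) ⟩
  (b +ℤ a) +ℤ coeff q α            ≡⟨ ℤ.+-assoc b a _ ⟩
  b +ℤ (a +ℤ coeff q α)            ≡⟨ cong (b +ℤ_) (coeff-∷ s q α) ⟨
  b +ℤ coeff (s ∷ q) α             ≡⟨ coeff-∷ t (s ∷ q) α ⟨
  coeff (t ∷ s ∷ q) α              ∎
  where
  open ≡-Reasoning
  a = coeff (s ∷ []) α
  b = coeff (t ∷ []) α
↭⇒≈ (↭.trans p↭q q↭r)   α = trans (↭⇒≈ p↭q α) (↭⇒≈ q↭r α)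

exponents : List (Fin n) → Vec ℕ n
exponents = foldr (λ i → zipWith _+ℕ_ (replicate _ 0 [ i ]≔ 1)) (replicate _ 0)

exponents-++ : ∀ (is js : List (Fin n)) →
               exponents (is ++ js) ≡ zipWith _+ℕ_ (exponents is) (exponents js)
exponents-++ []       js = sym (Vec.zipWith-identityˡ ℕ.+-identityˡ _)
exponents-++ (i ∷ is) js = trans (cong (zipWith _+ℕ_ _) (exponents-++ is js))
                                 (sym (Vec.zipWith-assoc ℕ.+-assoc _ _ _))

exponents-↭ : ∀ {is js : List (Fin n)} → is ↭ js → exponents is ≡ exponents js
exponents-↭ ↭.refl          = refl
exponents-↭ (↭.prep i p)    = cong (zipWith _+ℕ_ _) (exponents-↭ p)
exponents-↭ (↭.swap {xs = is} {js} i j p) = begin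
  zipWith _+ℕ_ x (zipWith _+ℕ_ y (exponents is)) ≡⟨ Vec.zipWith-assoc ℕ.+-assoc x y _ ⟨
  zipWith _+ℕ_ (zipWith _+ℕ_ x y) (exponents is)
    ≡⟨ cong₂ (zipWith _+ℕ_) (Vec.zipWith-comm ℕ.+-comm x y) (exponents-↭ p) ⟩
  zipWith _+ℕ_ (zipWith _+ℕ_ y x) (exponents js) ≡⟨ Vec.zipWith-assoc ℕ.+-assoc y x _ ⟩
  zipWith _+ℕ_ y (zipWith _+ℕ_ x (exponents js)) ∎
  where
  open ≡-Reasoning
  x = replicate _ 0 [ i ]≔ 1
  y = replicate _ 0 [ j ]≔ 1
exponents-↭ (↭.trans p q)   = trans (exponents-↭ p) (exponents-↭ q)

monomial : List (Fin n) → ℤ × Vec ℕ n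
monomial is = 1ℤ , exponents is

-- A product of one-term polynomials has one term, and its coefficient, a product of ones, computes
-- to `1ℤ`.
∏-var : ∀ (is : List (Fin n)) → ∏ (map var is) ≡ monomial is ∷ []
∏-var []       = refl
∏-var (i ∷ is) = cong (var i *ᴾ_) (∏-var is)

∑-monomials : ∀ (Ss : List (Subset n)) →
              ∑ (map (λ S → ∏ (map var (elements S))) Ss) ≡ map (monomial ∘ elements) Ss
∑-monomials []       = refl
∑-monomials (S ∷ Ss) = cong₂ _+ᴾ_ (∏-var (elements S)) (∑-monomials Ss)

-- Distributivity. Since `*ᴾ` and `choices` run through pairs in the same order, the two lists of
-- terms are literally equal.
∏-monomials : ∀ (Sss : List (List (Subset n))) →
              ∏ (map (map (monomial ∘ elements)) Sss) ≡
              map (monomial ∘ concat ∘ map elements) (choices Sss)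
∏-monomials []         = refl
∏-monomials (Ss ∷ Sss) = trans
  (cong (map (monomial ∘ elements) Ss *ᴾ_) (∏-monomials Sss))
  (sym (map-cartesianProductWith
          (λ S Ts → cong (1ℤ ,_) (exponents-++ (elements S) (concat (map elements Ts))))
          Ss (choices Sss)))

κ-monomials : ∀ (G : Digraph m) → κ G ≡ map (monomial ∘ elements) (arb G)
κ-monomials G = ∑-monomials (arb G)

∈-arb : ∀ (G : Digraph m) {A} → A ∈ˡ arb G ⇔ IsArborescence G A
∈-arb G = mk⇔ (λ A∈ → proj₂ (∈-filter⁻ (arborescence? G) {xs = subsets _} A∈))
              (∈-filter⁺ (arborescence? G) (subsets-complete _))

arb-unique : ∀ (G : Digraph m) → Unique (arb G)
arb-unique G = Unique.filter⁺ (arborescence? G) (subsets-unique _)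

-- Walks and strongly connected components

-- The form of `IsRootedAt` supplied by `rooted⇔`. The first two conditions compare edges only
-- through their targets, so they pass easily between `A` and its parts; only reachability needs
-- work on walks.
IsRoot : (G : Digraph m) → Subset m → Fin (order G) → Set
IsRoot G A r = NoEdgeInto G A r × InDegree≤1 G A × Reaches G A r

arborescence⁺ : ∀ (G : Digraph m) {A r} → A ⊆ edges G → r ∈ vertices G →
                IsRoot G A r → IsArborescence G A
arborescence⁺ G {A} A⊆ r∈ root =
  (λ {e} → A⊆ {e}) , _ , r∈ , Equivalence.to (rooted⇔ G A (λ {e} → A⊆ {e}) r∈) root

arborescence⁻ : ∀ (G : Digraph m) {A} → IsArborescence G A →
                ∃[ r ] (r ∈ vertices G × IsRoot G A r)
arborescence⁻ G {A} (A⊆ , r , r∈ , rooted) =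
  r , r∈ , Equivalence.from (rooted⇔ G A (λ {e} → A⊆ {e}) r∈) rooted

walk-mono : ∀ (G : Digraph m) {A B} → A ⊆ B → ∀ {u v} es →
            IsWalk G A u v es → IsWalk G B u v es
walk-mono G A⊆B []       p            = p
walk-mono G A⊆B (e ∷ es) (e∈ , s , p) = A⊆B e∈ , s , walk-mono G A⊆B es p

module _ {m} (G : Digraph m) where

  private
    V : Set
    V = Fin (order G)

    Reach : V → V → Set
    Reach u v = ∃ (IsWalk G (edges G) u v)

    reach? : ∀ u v → Dec (Reach u v)
    reach? = walk? G (edges G)

    reach-refl : ∀ {v} → Reach v v
    reach-refl = [] , refl

    reach-trans : ∀ {u v w} → Reach u v → Reach v w → Reach u w
    reach-trans (es , p) (fs , q) = es ++ fs , walk-++ G (edges G) es p q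

    reach-edge : ∀ {e} → e ∈ edges G → Reach (src G e) (tgt G e)
    reach-edge {e} e∈ = e ∷ [] , e∈ , refl , refl

    induced⇒reach : ∀ {W u v} → ∃ (IsWalk (induced G W) (edges (induced G W)) u v) → Reach u v
    induced⇒reach {W} (es , p) = es , go es p
      where
      go : ∀ {u v} es → IsWalk (induced G W) (edges (induced G W)) u v es →
           IsWalk G (edges G) u v es
      go []       p            = p
      go (e ∷ es) (e∈ , s , p) = proj₁ (∈⟦⟧⁻ (inducedEdge? G W) e∈) , s , go es p

    mutual? : ∀ v u → Dec (u ∈ vertices G × Reach u v × Reach v u)
    mutual? v u = (u ∈? vertices G) ×-dec reach? u v ×-dec reach? v u

  -- As a class of mutual reachability, the component of a vertex is computed directly, without a
  -- search for a maximal set.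
  scc : V → Subset (order G)
  scc v = ⟦ mutual? v ⟧

  v∈scc : ∀ {v} → v ∈ vertices G → v ∈ scc v
  v∈scc {v} v∈ = ∈⟦⟧⁺ (mutual? v) (v∈ , reach-refl , reach-refl)

  -- Each vertex on the walk is reached from `v` through `u` and reaches `v` through `w`, so the
  -- walk never leaves the class of `v`.
  scc-induced : ∀ {v u w} es → Reach w v → Reach v u → u ∈ vertices G →
                IsWalk G (edges G) u w es →
                IsWalk (induced G (scc v)) (edges (induced G (scc v))) u w es
  scc-induced     []       w⇝v v⇝u u∈ p               = p
  scc-induced {v} (e ∷ es) w⇝v v⇝u u∈ (e∈ , refl , p) =
    ∈⟦⟧⁺ (inducedEdge? G (scc v))
      ( e∈
      , ∈⟦⟧⁺ (mutual? v) (u∈ , reach-trans (reach-edge e∈) t⇝v , v⇝u)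
      , ∈⟦⟧⁺ (mutual? v) (tgt∈ G e∈ , t⇝v , v⇝t))
    , refl , scc-induced es w⇝v v⇝t (tgt∈ G e∈) p
    where
    t⇝v = reach-trans (es , p) w⇝v
    v⇝t = reach-trans v⇝u (reach-edge e∈)

  scc-stronglyConnected : ∀ {v} → v ∈ vertices G → StronglyConnected (induced G (scc v))
  scc-stronglyConnected {v} v∈ = (v , v∈scc v∈) , λ u w u∈ w∈ →
    let u∈V , u⇝v , v⇝u = ∈⟦⟧⁻ (mutual? v) u∈
        _   , w⇝v , v⇝w = ∈⟦⟧⁻ (mutual? v) w∈
        es  , p         = reach-trans u⇝v v⇝w
    in es , scc-induced es w⇝v v⇝u u∈V p

  scc-⊆ : ∀ {v} → scc v ⊆ vertices G
  scc-⊆ {v} u∈ = proj₁ (∈⟦⟧⁻ (mutual? v) u∈)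

  ⊆-scc : ∀ {W v} → W ⊆ vertices G → StronglyConnected (induced G W) → v ∈ W → W ⊆ scc v
  ⊆-scc {W} {v} W⊆ (_ , conn) v∈ {u} u∈ = ∈⟦⟧⁺ (mutual? v)
    (W⊆ u∈ , induced⇒reach (conn u v u∈ v∈) , induced⇒reach (conn v u v∈ u∈))

  scc-isSCC : ∀ {v} → v ∈ vertices G → IsSCC G (scc v)
  scc-isSCC {v} v∈ = scc-⊆ {v} , scc-stronglyConnected v∈ , λ W W⊆ sc scc⊆W →
    ⊆-antisym (⊆-scc W⊆ sc (scc⊆W (v∈scc v∈))) scc⊆W

  -- The class of `v` is strongly connected and contains `W`, so maximality of `W` applies.
  -- Disjointness of components follows from this.
  scc-unique : ∀ {W v} → IsSCC G W → v ∈ W → scc v ≡ W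
  scc-unique {W} {v} (W⊆ , sc , maximal) v∈ =
    maximal (scc v) (scc-⊆ {v}) (scc-stronglyConnected (W⊆ v∈)) (⊆-scc W⊆ sc v∈)

  scc-closed : ∀ {W u v} → IsSCC G W → u ∈ W → v ∈ vertices G → Reach u v → Reach v u → v ∈ W
  scc-closed {W} {u} isSCC u∈ v∈ u⇝v v⇝u =
    subst (_ ∈_) (scc-unique isSCC u∈) (∈⟦⟧⁺ (mutual? u) (v∈ , v⇝u , u⇝v))

  scc-reach : ∀ {W u v} → IsSCC G W → u ∈ W → v ∈ W → Reach u v
  scc-reach (_ , (_ , conn) , _) u∈ v∈ = induced⇒reach (conn _ _ u∈ v∈)

  -- Incoming edges and the two cases of `hat`

  incoming? : ∀ (W : Subset (order G)) e → Dec (e ∈ edges G × tgt G e ∈ W)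
  incoming? W e = (e ∈? edges G) ×-dec (tgt G e ∈? W)

  -- A description of the edge set of `hat G W` that is uniform in the two cases of its definition.
  incoming : Subset (order G) → Subset m
  incoming W = ⟦ incoming? W ⟧

  -- Indexing by the digraph lets a match on the view replace `hat G W` by its concrete form.
  data HatView (W : Subset (order G)) : Digraph m → Set where
    initial    : Empty (entering G W) → HatView W (induced G W)
    nonInitial : Nonempty (entering G W) → HatView W (withAux G W)

  hatView : ∀ W → HatView W (hat G W)
  hatView W with nonempty? (entering G W)
  ... | yes ne = nonInitial ne
  ... | no  em = initial em

  incoming-tgt : ∀ {W e} → e ∈ incoming W → tgt G e ∈ W
  incoming-tgt {W} e∈ = proj₂ (∈⟦⟧⁻ (incoming? W) e∈)

  incoming-disjoint : ∀ {W W′} → IsSCC G W → IsSCC G W′ → W ≢ W′ →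
                      DisjointSubsets (incoming W) (incoming W′)
  incoming-disjoint isSCC isSCC′ W≢ e∈ e∈′ =
    W≢ (trans (sym (scc-unique isSCC (incoming-tgt e∈))) (scc-unique isSCC′ (incoming-tgt e∈′)))

  hat-⊆-incoming : ∀ {W H} → HatView W H → edges H ⊆ incoming W
  hat-⊆-incoming {W} (initial _)    e∈ =
    let e∈E , _ , t∈ = ∈⟦⟧⁻ (inducedEdge? G W) e∈ in ∈⟦⟧⁺ (incoming? W) (e∈E , t∈)
  hat-⊆-incoming {W} (nonInitial _) e∈ with x∈p∪q⁻ _ _ e∈
  ... | inj₁ e∈′ = let e∈E , _ , t∈ = ∈⟦⟧⁻ (inducedEdge? G W) e∈′ in ∈⟦⟧⁺ (incoming? W) (e∈E , t∈)
  ... | inj₂ e∈′ = let e∈E , _ , t∈ = ∈⟦⟧⁻ (enteringEdge? G W) e∈′ in ∈⟦⟧⁺ (incoming? W) (e∈E , t∈)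

  incoming-⊆-hat : ∀ {W H} → HatView W H → incoming W ⊆ edges H
  incoming-⊆-hat {W} view {e} e∈ with ∈⟦⟧⁻ (incoming? W) e∈ | src G e ∈? W
  incoming-⊆-hat {W} (initial _)    e∈ | e∈E , t∈ | yes s∈ = ∈⟦⟧⁺ (inducedEdge? G W) (e∈E , s∈ , t∈)
  incoming-⊆-hat {W} (nonInitial _) e∈ | e∈E , t∈ | yes s∈ =
    x∈p∪q⁺ (inj₁ (∈⟦⟧⁺ (inducedEdge? G W) (e∈E , s∈ , t∈)))
  incoming-⊆-hat {W} (initial em)   e∈ | e∈E , t∈ | no  s∉ =
    ⊥-elim (em (_ , ∈⟦⟧⁺ (enteringEdge? G W) (e∈E , s∉ , t∈)))
  incoming-⊆-hat {W} (nonInitial _) e∈ | e∈E , t∈ | no  s∉ =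
    x∈p∪q⁺ (inj₂ (∈⟦⟧⁺ (enteringEdge? G W) (e∈E , s∉ , t∈)))

  auxSrc-∈ : ∀ W {e} → src G e ∈ W → auxSrc G W e ≡ suc (src G e)
  auxSrc-∈ W {e} s∈ with src G e ∈? W
  ... | yes _  = refl
  ... | no  s∉ = ⊥-elim (s∉ s∈)

  auxSrc-∉ : ∀ W {e} → src G e ∉ W → auxSrc G W e ≡ zero
  auxSrc-∉ W {e} s∉ with src G e ∈? W
  ... | yes s∈ = ⊥-elim (s∉ s∈)
  ... | no  _  = refl

  auxSrc-zero : ∀ W {e} → auxSrc G W e ≡ zero → src G e ∉ W
  auxSrc-zero W {e} eq with src G e ∈? W
  auxSrc-zero W {e} () | yes _
  auxSrc-zero W {e} _  | no s∉ = s∉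

  auxSrc-suc : ∀ W {e u} → auxSrc G W e ≡ suc u → src G e ≡ u
  auxSrc-suc W {e} eq with src G e ∈? W
  auxSrc-suc W {e} eq | yes _ = suc-injective eq
  auxSrc-suc W {e} () | no  _

  -- Restricting an arborescence to a component

  module _ {A : Subset m} (A⊆ : A ⊆ edges G) where

    incoming⁺ : ∀ {W e} → e ∈ A → tgt G e ∈ W → e ∈ A ∩ incoming W
    incoming⁺ {W} e∈ t∈ = x∈p∩q⁺ (e∈ , ∈⟦⟧⁺ (incoming? W) (A⊆ e∈ , t∈))

    A∩⊆A : ∀ {W} → A ∩ incoming W ⊆ A
    A∩⊆A {W} e∈ = proj₁ (x∈p∩q⁻ A (incoming W) e∈)

    A∩⊆hat : ∀ {W H} → HatView W H → A ∩ incoming W ⊆ edges H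
    A∩⊆hat {W} view e∈ = incoming-⊆-hat view (proj₂ (x∈p∩q⁻ A (incoming W) e∈))

    -- Read backwards from `v`, the walk cannot leave `W`: an edge with target in `W` and source
    -- outside would enter `W`.
    walk-into-initial : ∀ {W} → Empty (entering G W) → ∀ {u v} es → v ∈ W → IsWalk G A u v es →
                        u ∈ W × IsWalk (induced G W) (A ∩ incoming W) u v es
    walk-into-initial em [] v∈ refl = v∈ , refl
    walk-into-initial {W} em (e ∷ es) v∈ (e∈ , refl , p) with walk-into-initial em es v∈ p
    ... | t∈ , q with src G e ∈? W
    ... | yes s∈ = s∈ , incoming⁺ e∈ t∈ , refl , q
    ... | no  s∉ = ⊥-elim (em (e , ∈⟦⟧⁺ (enteringEdge? G W) (A⊆ e∈ , s∉ , t∈)))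

    -- The second alternative says that the whole walk stays in `W`. Once some tail gives a walk
    -- from the auxiliary vertex, all earlier edges are dropped, which cuts the walk at its last
    -- entrance.
    walk-into : ∀ {W u v} es → v ∈ W → IsWalk G A u v es →
                ∃ (IsWalk (withAux G W) (A ∩ incoming W) zero (suc v)) ⊎
                (u ∈ W × ∃ (IsWalk (withAux G W) (A ∩ incoming W) (suc u) (suc v)))
    walk-into [] v∈ refl = inj₂ (v∈ , [] , refl)
    walk-into {W} (e ∷ es) v∈ (e∈ , refl , p) with walk-into es v∈ p
    ... | inj₁ q = inj₁ q
    ... | inj₂ (t∈ , fs , q) with src G e ∈? W
    ... | yes s∈ = inj₂ (s∈ , e ∷ fs , incoming⁺ e∈ t∈ , auxSrc-∈ W s∈ , q)
    ... | no  s∉ = inj₁ (e ∷ fs , incoming⁺ e∈ t∈ , auxSrc-∉ W s∉ , q)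

    hat-inDegree≤1 : ∀ {W H} → HatView W H → InDegree≤1 H (A ∩ incoming W) →
                     ∀ {e f} → e ∈ A ∩ incoming W → f ∈ A ∩ incoming W →
                     tgt G e ≡ tgt G f → e ≡ f
    hat-inDegree≤1 (initial _)    d e∈ f∈ eq = d _ e∈ _ f∈ eq
    hat-inDegree≤1 (nonInitial _) d e∈ f∈ eq = d _ e∈ _ f∈ (cong suc eq)

    walk-from-initial : ∀ {W u v} es → IsWalk (induced G W) (A ∩ incoming W) u v es →
                        IsWalk G A u v es
    walk-from-initial     []       p            = p
    walk-from-initial {W} (e ∷ es) (e∈ , s , p) = A∩⊆A {W} e∈ , s , walk-from-initial es p

    -- All targets have the form `suc _`, so a walk that starts at an old vertex never meets the
    -- auxiliary one.
    walk-from-withAux : ∀ {W u v} es → IsWalk (withAux G W) (A ∩ incoming W) (suc u) (suc v) es →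
                        IsWalk G A u v es
    walk-from-withAux     []       refl         = refl
    walk-from-withAux {W} (e ∷ es) (e∈ , s , p) =
      A∩⊆A {W} e∈ , auxSrc-suc W s , walk-from-withAux es p

  restrict-arborescence : ∀ {A W H} → HatView W H → IsSCC G W → IsArborescence G A →
                          IsArborescence H (A ∩ incoming W)
  restrict-arborescence {A} {W} view isSCC@(W⊆ , ((w , w∈) , _) , _) A-arb@(A⊆ , _)
    with arborescence⁻ G A-arb
  restrict-arborescence {A} {W} view@(initial em) isSCC@(W⊆ , ((w , w∈) , _) , _) (A⊆ , _)
    | r , r∈ , noEdge , d , reach =
    arborescence⁺ (induced G W) (A∩⊆hat A⊆ view)
      -- The root lies in `W` because it reaches `w`, and no walk enters `W` from outside.
      (let es , p = reach w (W⊆ w∈) in proj₁ (walk-into-initial A⊆ em es w∈ p))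
      ( (λ e e∈ → noEdge e (A∩⊆A A⊆ {W} e∈))
      , (λ e e∈ f f∈ → d e (A∩⊆A A⊆ {W} e∈) f (A∩⊆A A⊆ {W} f∈))
      , λ v v∈ → let es , p = reach v (W⊆ v∈)
                 in es , proj₂ (walk-into-initial A⊆ em es v∈ p) )
  restrict-arborescence {A} {W} view@(nonInitial (f , f∈)) isSCC@(W⊆ , ((w , w∈) , _) , _) (A⊆ , _)
    | r , r∈ , noEdge , d , reach =
    arborescence⁺ (withAux G W) (A∩⊆hat A⊆ view) Vec.here
      ( (λ _ _ ())
      , (λ e e∈ f f∈ eq → d e (A∩⊆A A⊆ {W} e∈) f (A∩⊆A A⊆ {W} f∈) (suc-injective eq))
      , reach′ )
    where
    -- If the root were in `W`, the source of the entering edge `f` would be reachable from `W` and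
    -- reach `W` through `f`, hence would itself lie in `W`.
    r∉W : r ∉ W
    r∉W r∈W =
      let f∈E , s∉ , t∈ = ∈⟦⟧⁻ (enteringEdge? G W) f∈
          es , p        = reach (src G f) (src∈ G f∈E)
      in s∉ (scc-closed isSCC r∈W (src∈ G f∈E) (es , walk-mono G A⊆ es p)
              (reach-trans (reach-edge f∈E) (scc-reach isSCC t∈ r∈W)))

    reach′ : Reaches (withAux G W) (A ∩ incoming W) zero
    reach′ zero    _             = [] , refl
    reach′ (suc v) (Vec.there v∈) with reach v (W⊆ v∈)
    ... | es , p with walk-into A⊆ es v∈ p
    ... | inj₁ q         = q
    ... | inj₂ (r∈W , _) = ⊥-elim (r∉W r∈W)

  -- Gluing arborescences of the components

  withAux-root : ∀ {W A} → IsArborescence (withAux G W) A → IsRoot (withAux G W) A zero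
  withAux-root {W} {A} arb with arborescence⁻ (withAux G W) arb
  ... | zero  , _ , root          = root
  -- A root must reach the auxiliary vertex, but no edge ends there.
  ... | suc r , _ , _ , _ , reach with reach zero Vec.here
  ... | es , p = ⊥-elim (no-walk-to-zero es p)
    where
    no-walk-to-zero : ∀ {u} es → ¬ IsWalk (withAux G W) A (suc u) zero es
    no-walk-to-zero []       ()
    no-walk-to-zero (e ∷ es) (_ , _ , p) = no-walk-to-zero es p

  ancestors : V → Subset (order G)
  ancestors v = ⟦ (λ u → reach? u v) ⟧

  -- The inclusion is strict because of `v` itself: if `v` reached the source of `e`, that source
  -- would belong to `W`.
  ancestors-entering : ∀ {W e v} → IsSCC G W → e ∈ entering G W → v ∈ W →
                       ancestors (src G e) ⊂ ancestors v
  ancestors-entering {W} {e} {v} isSCC e∈ v∈ =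
      (λ u∈ → ∈⟦⟧⁺ (λ u → reach? u v) (reach-trans (∈⟦⟧⁻ (λ u → reach? u (src G e)) u∈) s⇝v))
    , v , ∈⟦⟧⁺ (λ u → reach? u v) reach-refl
    , λ v∈anc → s∉ (scc-closed isSCC v∈ (src∈ G e∈E) (∈⟦⟧⁻ (λ u → reach? u (src G e)) v∈anc) s⇝v)
    where
    e∈E = proj₁ (∈⟦⟧⁻ (enteringEdge? G W) e∈)
    s∉  = proj₁ (proj₂ (∈⟦⟧⁻ (enteringEdge? G W) e∈))
    t∈  = proj₂ (proj₂ (∈⟦⟧⁻ (enteringEdge? G W) e∈))
    s⇝v = reach-trans (reach-edge e∈E) (scc-reach isSCC t∈ v∈)

  module _ {A W₀} (A⊆ : A ⊆ edges G) (W₀-initial : IsInitialComponent G W₀)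
           (W₀-unique : ∀ {W} → IsInitialComponent G W → W₀ ≡ W)
           (hat-arb : ∀ {W} → IsSCC G W → IsArborescence (hat G W) (A ∩ incoming W)) where

    private
      rootOf : ∀ {H} → HatView W₀ H → IsArborescence H (A ∩ incoming W₀) →
               ∃[ r ] (r ∈ W₀ × IsRoot (induced G W₀) (A ∩ incoming W₀) r)
      rootOf (initial _)     arb = arborescence⁻ (induced G W₀) arb
      rootOf (nonInitial ne) arb = ⊥-elim (proj₂ W₀-initial ne)

      root₀ = rootOf (hatView W₀) (hat-arb (proj₁ W₀-initial))
      r     = proj₁ root₀
      r∈    = proj₁ (proj₂ root₀)

      noEdgeInto : NoEdgeInto G A r
      noEdgeInto e e∈ t≡r = proj₁ (proj₂ (proj₂ root₀)) e
        (incoming⁺ A⊆ e∈ (subst (_∈ W₀) (sym t≡r) r∈)) t≡r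

      -- Two edges with a common target lie in the same part, that of the component of the target,
      -- where the bound is known.
      inDegree≤1 : InDegree≤1 G A
      inDegree≤1 e e∈ f f∈ eq =
        hat-inDegree≤1 A⊆ (hatView W) (proj₁ (proj₂ (proj₂ (proj₂ root))))
          (incoming⁺ A⊆ e∈ t∈) (incoming⁺ A⊆ f∈ (subst (_∈ W) eq t∈)) eq
        where
        W    = scc (tgt G e)
        t∈   = v∈scc (tgt∈ G (A⊆ e∈))
        root = arborescence⁻ (hat G W) (hat-arb (scc-isSCC (tgt∈ G (A⊆ e∈))))

      reaches : ∀ v → v ∈ vertices G → Acc _⊂_ (ancestors v) → ∃ (IsWalk G A r v)
      reaches v v∈ (acc rec) = go (hatView W) (hat-arb isSCC)
        where
        W = scc v

        isSCC : IsSCC G W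
        isSCC = scc-isSCC v∈

        go : ∀ {H} → HatView W H → IsArborescence H (A ∩ incoming W) → ∃ (IsWalk G A r v)
        -- With no entering edge, `W` is an initial component, so it is `W₀` and the root already
        -- reaches `v` inside it.
        go (initial em) _ =
          let es , p = proj₂ (proj₂ (proj₂ (proj₂ root₀))) v
                         (subst (v ∈_) (sym (W₀-unique (isSCC , em))) (v∈scc v∈))
          in es , walk-from-initial A⊆ es p
        go (nonInitial _) arb with proj₂ (proj₂ (withAux-root arb)) (suc v) (Vec.there (v∈scc v∈))
        -- The walk is nonempty since `zero` differs from `suc v`. Its first edge `e` leaves the
        -- auxiliary vertex, so in `G` it enters `W` from a vertex with fewer ancestors, to which
        -- the induction applies.
        ... | e ∷ es , e∈ , s≡0 , p =
          let e∈A      = A∩⊆A A⊆ {W} e∈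
              t∈       = incoming-tgt (proj₂ (x∈p∩q⁻ A (incoming W) e∈))
              entering = ∈⟦⟧⁺ (enteringEdge? G W) (A⊆ e∈A , auxSrc-zero W s≡0 , t∈)
              fs , q   = reaches (src G e) (src∈ G (A⊆ e∈A))
                           (rec (ancestors-entering isSCC entering (v∈scc v∈)))
          in fs ++ e ∷ es , walk-++ G A fs q (e∈A , refl , walk-from-withAux A⊆ es p)

    glue-arborescence : IsArborescence G A
    glue-arborescence = arborescence⁺ G A⊆ (proj₁ (proj₁ W₀-initial) r∈)
      (noEdgeInto , inDegree≤1 , λ v v∈ → reaches v v∈ (⊂-wellFounded _))

-- Factorisation of the Kirchhoff polynomial

theorem4p1 : ∀ {m : ℕ} (G : Digraph m) (Ws : List (Subset (order G))) →
    Connected G →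
    AreAllSCCs G Ws →
    ∃! _≡_ (IsInitialComponent G) →
    κ G ≈ ∏ (map (λ W → κ (hat G W)) Ws)
theorem4p1 G Ws _ (Ws! , ∈Ws) (W₀ , W₀-initial , W₀-unique) α = begin
  coeff (κ G) α
    ≡⟨ cong (λ p → coeff p α) (κ-monomials G) ⟩
  coeff (map (monomial ∘ elements) (arb G)) α
    -- Grouping the edges of each arborescence by component permutes them and leaves the exponent
    -- vector unchanged.
    ≡⟨ cong (λ p → coeff p α) (map-cong-local (All.tabulate λ A∈ →
         cong (1ℤ ,_) (exponents-↭ (elements-↭ Es# (cover (arb-⊆ A∈)))))) ⟩
  coeff (map (product ∘ split) (arb G)) α
    ≡⟨ cong (λ p → coeff p α) (map-∘ (arb G)) ⟩
  coeff (map product (map split (arb G))) α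
    -- Arborescences of `G` correspond to choices of one arborescence per component; the two
    -- enumerations may differ in order, which coefficients ignore.
    ≡⟨ ↭⇒≈ (↭.map⁺ product (bijection⇒↭ split ⋃ (arb-unique G) hats-unique split-arb ⋃-choice)) α ⟩
  coeff (map product (choices hats)) α
    ≡⟨ cong (λ p → coeff p α) (∏-monomials hats) ⟨
  coeff (∏ (map (map (monomial ∘ elements)) hats)) α
    ≡⟨ cong (λ ps → coeff (∏ ps) α)
         (trans (sym (map-∘ Ws)) (map-cong (λ W → sym (κ-monomials (hat G W))) Ws)) ⟩
  coeff (∏ (map (λ W → κ (hat G W)) Ws)) α ∎
  where
  open ≡-Reasoning

  Es      = map (incoming G) Ws
  hats    = map (λ W → arb (hat G W)) Ws
  split   = λ A → map (A ∩_) Es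
  product = monomial ∘ concat ∘ map elements

  Ws-SCC : All (IsSCC G) Ws
  Ws-SCC = All.tabulate (Equivalence.to (∈Ws _))

  Es# : AllPairs DisjointSubsets Es
  Es# = AllPairs.map⁺ (allPairs-zipWith (incoming-disjoint G) Ws-SCC Ws!)

  cover : ∀ {A} → A ⊆ edges G → ∀ {e} → e ∈ A → Any (e ∈_) Es
  cover A⊆ e∈ = Any.map⁺ (lose
    (Equivalence.from (∈Ws _) (scc-isSCC G (tgt∈ G (A⊆ e∈))))
    (∈⟦⟧⁺ (incoming? G _) (A⊆ e∈ , v∈scc G (tgt∈ G (A⊆ e∈)))))

  arb-⊆ : ∀ {A} → A ∈ˡ arb G → A ⊆ edges G
  arb-⊆ A∈ = proj₁ (Equivalence.to (∈-arb G) A∈)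

  hats-unique : Unique (choices hats)
  hats-unique = choices-unique {xss = hats} (All.map⁺ (All.tabulate (λ {W} _ → arb-unique (hat G W))))

  split-arb : ∀ {A} → A ∈ˡ arb G → split A ∈ˡ choices hats × ⋃ (split A) ≡ A
  split-arb {A} A∈ =
    ∈-choices⁺ (subst (λ Bs → Pointwise _∈ˡ_ Bs hats) (map-∘ Ws) (pointwise-map⁺
      (All.map (λ {W} isSCC → Equivalence.from (∈-arb (hat G W))
        (restrict-arborescence G (hatView G W) isSCC (Equivalence.to (∈-arb G) A∈))) Ws-SCC)))
    , ⋃-parts (cover (arb-⊆ A∈))

  ⋃-choice : ∀ {Bs} → Bs ∈ˡ choices hats → ⋃ Bs ∈ˡ arb G × split (⋃ Bs) ≡ Bs
  ⋃-choice {Bs} Bs∈ =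
    Equivalence.from (∈-arb G) (glue-arborescence G ⋃⊆ W₀-initial W₀-unique hat-arb) , parts
    where
    Bs⊆ : Pointwise _⊆_ Bs Es
    Bs⊆ = pointwise-mapʳ
      (λ {_} {W} B∈ {_} e∈ → hat-⊆-incoming G (hatView G W) (proj₁ (Equivalence.to (∈-arb (hat G W)) B∈) e∈))
      Ws (∈-choices⁻ hats Bs∈)

    parts : split (⋃ Bs) ≡ Bs
    parts = ⋃-∩-parts Es# Bs⊆

    ⋃⊆ : ⋃ Bs ⊆ edges G
    ⋃⊆ e∈ with find (Any.map⁻ (any-Pointwise (λ B⊆E e∈B → B⊆E e∈B) Bs⊆ (∈-⋃⁻ Bs e∈)))
    ... | W , _ , e∈W = proj₁ (∈⟦⟧⁻ (incoming? G W) e∈W)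

    -- By `parts`, the piece of `⋃ Bs` over `W` is the entry of `Bs` chosen for `W`, which comes
    -- from `arb (hat G W)`.
    hat-arb : ∀ {W} → IsSCC G W → IsArborescence (hat G W) (⋃ Bs ∩ incoming G W)
    hat-arb {W} isSCC = Equivalence.to (∈-arb (hat G W)) (All.lookup
      (pointwise-map⁻ Ws (subst (λ Bs → Pointwise _∈ˡ_ Bs hats) (trans (sym parts) (sym (map-∘ Ws)))
        (∈-choices⁻ hats Bs∈)))
      (Equivalence.from (∈Ws W) isSCC))
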